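{- Let $(A,G)$ be a genoid. Then $(A,G)$ is reflexive if and only if it is the underlying genoid of a reflexive lambda genoid; and $(A,G)$ is extensive if and only if it is the underlying genoid of an extensive lambda genoid.
   Context: A genoid $(A,G)=(A,G,x,+,[\ ])$ consists of a monoid $(G,e)$ with unit $e$, a right act $A$ of $G$ (a set with an associative, unital right action of $G$), an element $x\in A$, an element $+\in G$, and a map $[\ ]:A\times G\to G$, $(a,u)\mapsto[a,u]$, such that for all $a\in A$ and $u\in G$: (G1) $x[a,u]=a$; (G2) $+[a,u]=u$; (G3) $u=[xu,+u]$. Products in $G$ and the action of $G$ are written by juxtaposition; thus $a+$ denotes the action of the element $+\in G$ on $a$. Homomorphisms of right acts of $G$ are $G$-equivariant maps; products of acts are cartesian products with componentwise action. $A^A=(A,\circ)$ denotes the right act of $G$ with the same underlying set as $A$ and with action $a\circ u=a[x,u+]$ for $a\in A$, $u\in G$. The genoid $(A,G)$ is reflexive if $A^A$ is a retract of $A$ as right acts of $G$, i.e. there are homomorphisms $s:A^A\to A$ and $r:A\to A^A$ of right acts with $r(s(a))=a$ for all $a$. It is extensive if $A^A$ is isomorphic to $A$ as right acts of $G$. A lambda genoid is a genoid $(A,G)$ together with two homomorphisms of right acts of $G$, $\lambda:A^A\to A$ and $\cdot:A\times A\to A$. It is a reflexive lambda genoid if $((\lambda a)+)\cdot x=a$ for every $a\in A$. It is an extensive lambda genoid if in addition $\lambda((a+)\cdot x)=a$ for every $a\in A$. The underlying genoid of a lambda genoid is obtained by forgetting $\lambda$ and $\cdot$. -}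

module Defs where

open import Algebra.Bundles using (Monoid)
open import Algebra.Module.Core using (Opᵣ)
import Algebra.Module.Definitions.Right as RightDefs
import Algebra.Module.Morphism.Definitions as MorphismDefs
open import Data.Product using (_×_; _,_; ∃-syntax)
open import Data.Product.Relation.Binary.Pointwise.NonDependent using (×-setoid)
open import Function.Bundles using (Func)
open import Level using (Level; _⊔_; suc)
open import Relation.Binary.Bundles using (Setoid)
open import Relation.Binary.PropositionalEquality using (_≡_)
import Relation.Binary.Reasoning.Setoid as SetoidReasoning

private
  variable
    a ℓa b ℓb g ℓg : Level

-- As in the standard library's algebraic hierarchy, sets are setoids and maps
-- respect their equalities; sets in the ordinary sense are the case where the
-- equalities are _≡_.

module _ (G : Monoid g ℓg) where

  open Monoid G using (_∙_; ε) renaming (Carrier to ∣G∣; _≈_ to _≈ᴳ_)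

  record RightAct (a ℓa : Level) : Set (suc (a ⊔ ℓa) ⊔ g ⊔ ℓg) where
    infixl 8 _◁_
    field
      setoid : Setoid a ℓa
    open Setoid setoid public
    open RightDefs ∣G∣ _≈_
    field
      _◁_         : Opᵣ ∣G∣ Carrier
      ◁-cong      : Congruent _≈ᴳ_ _◁_
      ◁-identityʳ : RightIdentity ε _◁_
      ◁-assoc     : Associative _∙_ _◁_

module _ {G : Monoid g ℓg} where

  open Monoid G using () renaming (Carrier to ∣G∣)

  record Hom (A : RightAct G a ℓa) (B : RightAct G b ℓb)
             : Set (a ⊔ ℓa ⊔ b ⊔ ℓb ⊔ g) where
    private
      module A = RightAct A
      module B = RightAct B
    open MorphismDefs ∣G∣ A.Carrier B.Carrier B._≈_ using (Homomorphicᵣ)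
    field
      func : Func A.setoid B.setoid
    open Func func public using (to; cong)
    field
      homo : Homomorphicᵣ to A._◁_ B._◁_

  infixr 2 _×ᴬ_

  _×ᴬ_ : RightAct G a ℓa → RightAct G b ℓb → RightAct G (a ⊔ b) (ℓa ⊔ ℓb)
  A ×ᴬ B = record
    { setoid      = ×-setoid A.setoid B.setoid
    ; _◁_         = λ { (p , q) u → p A.◁ u , q B.◁ u }
    ; ◁-cong      = λ { (p , q) r → A.◁-cong p r , B.◁-cong q r }
    ; ◁-identityʳ = λ { (p , q) → A.◁-identityʳ p , B.◁-identityʳ q }
    ; ◁-assoc     = λ { (p , q) u v → A.◁-assoc p u v , B.◁-assoc q u v }
    }
    where
    module A = RightAct A
    module B = RightAct B

  record IsRetractOf (B : RightAct G b ℓb) (A : RightAct G a ℓa)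
                     : Set (a ⊔ ℓa ⊔ b ⊔ ℓb ⊔ g) where
    open RightAct B using (_≈_)
    field
      section    : Hom B A
      retraction : Hom A B
      retract    : ∀ p → Hom.to retraction (Hom.to section p) ≈ p

  record IsIsomorphicTo (B : RightAct G b ℓb) (A : RightAct G a ℓa)
                        : Set (a ⊔ ℓa ⊔ b ⊔ ℓb ⊔ g) where
    private
      module A = RightAct A
      module B = RightAct B
    field
      forth      : Hom B A
      back       : Hom A B
      back∘forth : ∀ p → Hom.to back (Hom.to forth p) B.≈ p
      forth∘back : ∀ p → Hom.to forth (Hom.to back p) A.≈ p

record Genoid (a ℓa g ℓg : Level) : Set (suc (a ⊔ ℓa ⊔ g ⊔ ℓg)) where
  field
    monoid : Monoid g ℓg
    act    : RightAct monoid a ℓa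

  module G = Monoid monoid
  open G using (_∙_; ε) renaming (Carrier to ∣G∣; _≈_ to _≈ᴳ_) public
  module A = RightAct act
  open A using (_◁_) renaming (Carrier to ∣A∣; _≈_ to _≈ᴬ_) public

  field
    x        : ∣A∣
    +        : ∣G∣
    [_,_]    : ∣A∣ → ∣G∣ → ∣G∣
    [,]-cong : ∀ {p q u v} → p ≈ᴬ q → u ≈ᴳ v → [ p , u ] ≈ᴳ [ q , v ]
    G1       : ∀ p u → x ◁ [ p , u ] ≈ᴬ p
    G2       : ∀ p u → + ∙ [ p , u ] ≈ᴳ u
    G3       : ∀ u → u ≈ᴳ [ x ◁ u , + ∙ u ]

  [,]-∙ : ∀ p u v → [ p , u ] ∙ v ≈ᴳ [ p ◁ v , u ∙ v ]
  [,]-∙ p u v = begin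
    [ p , u ] ∙ v
      ≈⟨ G3 _ ⟩
    [ x ◁ ([ p , u ] ∙ v) , + ∙ ([ p , u ] ∙ v) ]
      ≈⟨ [,]-cong (A.◁-assoc _ _ _) (G.assoc _ _ _) ⟨
    [ x ◁ [ p , u ] ◁ v , (+ ∙ [ p , u ]) ∙ v ]
      ≈⟨ [,]-cong (A.◁-cong (G1 p u) G.refl) (G.∙-cong (G2 p u) G.refl) ⟩
    [ p ◁ v , u ∙ v ] ∎
    where open SetoidReasoning G.setoid

  infixl 8 _∘_
  _∘_ : ∣A∣ → ∣G∣ → ∣A∣
  p ∘ u = p ◁ [ x , u ∙ + ]

  [x,ε∙+]≈ε : [ x , ε ∙ + ] ≈ᴳ ε
  [x,ε∙+]≈ε = begin
    [ x , ε ∙ + ]     ≈⟨ [,]-cong (A.sym (A.◁-identityʳ x))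
                                  (G.trans (G.identityˡ +) (G.sym (G.identityʳ +))) ⟩
    [ x ◁ ε , + ∙ ε ] ≈⟨ G3 ε ⟨
    ε                 ∎
    where open SetoidReasoning G.setoid

  [x,∙+]-∙ : ∀ u v → [ x , u ∙ + ] ∙ [ x , v ∙ + ] ≈ᴳ [ x , (u ∙ v) ∙ + ]
  [x,∙+]-∙ u v = begin
    [ x , u ∙ + ] ∙ [ x , v ∙ + ]
      ≈⟨ [,]-∙ _ _ _ ⟩
    [ x ◁ [ x , v ∙ + ] , (u ∙ +) ∙ [ x , v ∙ + ] ]
      ≈⟨ [,]-cong (G1 _ _) (G.assoc _ _ _) ⟩
    [ x , u ∙ (+ ∙ [ x , v ∙ + ]) ]
      ≈⟨ [,]-cong A.refl (G.∙-cong G.refl (G2 _ _)) ⟩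
    [ x , u ∙ (v ∙ +) ]
      ≈⟨ [,]-cong A.refl (G.assoc _ _ _) ⟨
    [ x , (u ∙ v) ∙ + ] ∎
    where open SetoidReasoning G.setoid

  -- The act written A^A (an exponent) in the mathematics.
  act^act : RightAct monoid a ℓa
  act^act = record
    { setoid      = A.setoid
    ; _◁_         = _∘_
    ; ◁-cong      = λ p u → A.◁-cong p ([,]-cong A.refl (G.∙-cong u G.refl))
    ; ◁-identityʳ = λ p → A.trans (A.◁-cong A.refl [x,ε∙+]≈ε) (A.◁-identityʳ p)
    ; ◁-assoc     = λ p u v →
        A.trans (A.◁-assoc _ _ _) (A.◁-cong A.refl ([x,∙+]-∙ u v))
    }

Reflexive : Genoid a ℓa g ℓg → Set (a ⊔ ℓa ⊔ g)
Reflexive 𝒢 = IsRetractOf act^act act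
  where open Genoid 𝒢

Extensive : Genoid a ℓa g ℓg → Set (a ⊔ ℓa ⊔ g)
Extensive 𝒢 = IsIsomorphicTo act^act act
  where open Genoid 𝒢

record LambdaGenoid (a ℓa g ℓg : Level) : Set (suc (a ⊔ ℓa ⊔ g ⊔ ℓg)) where
  field
    genoid : Genoid a ℓa g ℓg
  open Genoid genoid public
  field
    abstraction : Hom act^act act
    application : Hom (act ×ᴬ act) act

  ƛ : ∣A∣ → ∣A∣
  ƛ = Hom.to abstraction

  infixl 7 _·_
  _·_ : ∣A∣ → ∣A∣ → ∣A∣
  p · q = Hom.to application (p , q)

record IsReflexiveLambda (Λ : LambdaGenoid a ℓa g ℓg) : Set (a ⊔ ℓa) where
  open LambdaGenoid Λ
  field
    β : ∀ p → (ƛ p ◁ +) · x ≈ᴬ p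

record IsExtensiveLambda (Λ : LambdaGenoid a ℓa g ℓg) : Set (a ⊔ ℓa) where
  open LambdaGenoid Λ
  field
    isReflexiveLambda : IsReflexiveLambda Λ
    η                 : ∀ p → ƛ ((p ◁ +) · x) ≈ᴬ p
  open IsReflexiveLambda isReflexiveLambda public

UnderliesReflexiveLambda : Genoid a ℓa g ℓg → Set (suc (a ⊔ ℓa ⊔ g ⊔ ℓg))
UnderliesReflexiveLambda {a} {ℓa} {g} {ℓg} 𝒢 =
  ∃[ Λ ] LambdaGenoid.genoid {a} {ℓa} {g} {ℓg} Λ ≡ 𝒢 × IsReflexiveLambda Λ

UnderliesExtensiveLambda : Genoid a ℓa g ℓg → Set (suc (a ⊔ ℓa ⊔ g ⊔ ℓg))
UnderliesExtensiveLambda {a} {ℓa} {g} {ℓg} 𝒢 =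
  ∃[ Λ ] LambdaGenoid.genoid {a} {ℓa} {g} {ℓg} Λ ≡ 𝒢 × IsExtensiveLambda Λ

{-# OPTIONS --safe #-}

-- The exponent A^A deserves its name: currying r p = (p +) · x and uncurrying
-- p · q = (r p) [q, e] relate homomorphisms · : A × A → A and r : A → A^A, and
-- currying undoes uncurrying.  Under this correspondence β and η say that
-- r ∘ λ and λ ∘ r are the identity.

module Submission where

open import Defs
open import Data.Product using (_×_; _,_)
open import Function.Bundles using (_⇔_; mk⇔)
open import Level using (Level)
open import Relation.Binary.PropositionalEquality using (refl)
import Relation.Binary.Reasoning.Setoid as SetoidReasoning

private
  variable
    a ℓa g ℓg : Level

module _ (𝒢 : Genoid a ℓa g ℓg) where

  open Genoid 𝒢

  [x,+]≈ε : [ x , + ] ≈ᴳ ε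
  [x,+]≈ε = G.trans ([,]-cong A.refl (G.sym (G.identityˡ +))) [x,ε∙+]≈ε

  -- Read as substitution: `∘ u` acts by `u` under a binder, keeping the bound variable `x` fixed.
  -- Composing with `[ q , v ]` then fills `x` with `q` by `G1` and turns the trailing `+` into `v`
  -- by `G2`.
  ∘-◁-[,] : ∀ p u q v → (p ∘ u) ◁ [ q , v ] ≈ᴬ p ◁ [ q , u ∙ v ]
  ∘-◁-[,] p u q v = begin
    p ◁ [ x , u ∙ + ] ◁ [ q , v ]
      ≈⟨ A.◁-assoc _ _ _ ⟩
    p ◁ ([ x , u ∙ + ] ∙ [ q , v ])
      ≈⟨ A.◁-cong A.refl ([,]-∙ _ _ _) ⟩
    p ◁ [ x ◁ [ q , v ] , (u ∙ +) ∙ [ q , v ] ]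
      ≈⟨ A.◁-cong A.refl ([,]-cong (G1 q v)
           (G.trans (G.assoc _ _ _) (G.∙-cong G.refl (G2 q v)))) ⟩
    p ◁ [ q , u ∙ v ] ∎
    where open SetoidReasoning A.setoid

  -- Equivariance holds because `[ x , u ∙ + ]` fixes `x` and lets `u` pass across the weakening
  -- `+`.
  curry : Hom (act ×ᴬ act) act → Hom act act^act
  curry app = record
    { func = record
      { to   = λ p → to (p ◁ + , x)
      ; cong = λ p≈q → cong (A.◁-cong p≈q G.refl , A.refl)
      }
    ; homo = λ u p → begin
        to (p ◁ u ◁ + , x)
          -- `G1`, read backwards, gives both components the same acting element, so that `homo`
          -- applies.
          ≈⟨ cong (◁+-shift p u , A.sym (G1 _ _)) ⟩
        to (p ◁ + ◁ [ x , u ∙ + ] , x ◁ [ x , u ∙ + ])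
          ≈⟨ homo _ _ ⟩
        to (p ◁ + , x) ∘ u ∎
    }
    where
    open Hom app
    open SetoidReasoning A.setoid

    ◁+-shift : ∀ p u → p ◁ u ◁ + ≈ᴬ p ◁ + ◁ [ x , u ∙ + ]
    ◁+-shift p u = begin
      p ◁ u ◁ +                   ≈⟨ A.◁-assoc _ _ _ ⟩
      p ◁ (u ∙ +)                 ≈⟨ A.◁-cong A.refl (G2 _ _) ⟨
      p ◁ (+ ∙ [ x , u ∙ + ])     ≈⟨ A.◁-assoc _ _ _ ⟨
      p ◁ + ◁ [ x , u ∙ + ]       ∎

  -- `[ q , ε ]` substitutes `q` for `x` in the body `to p` and leaves the rest alone. Both sides of
  -- equivariance amount to `to p` acted on by `[ q ◁ u , u ]`.
  uncurry : Hom act act^act → Hom (act ×ᴬ act) act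
  uncurry r = record
    { func = record
      { to   = λ { (p , q) → to p ◁ [ q , ε ] }
      ; cong = λ { (p≈p′ , q≈q′) → A.◁-cong (cong p≈p′) ([,]-cong q≈q′ G.refl) }
      }
    ; homo = λ { u (p , q) → begin
        to (p ◁ u) ◁ [ q ◁ u , ε ]
          ≈⟨ A.◁-cong (homo u p) G.refl ⟩
        (to p ∘ u) ◁ [ q ◁ u , ε ]
          ≈⟨ ∘-◁-[,] _ _ _ _ ⟩
        to p ◁ [ q ◁ u , u ∙ ε ]
          ≈⟨ A.◁-cong A.refl ([,]-cong A.refl
               (G.trans (G.identityʳ u) (G.sym (G.identityˡ u)))) ⟩
        to p ◁ [ q ◁ u , ε ∙ u ]
          ≈⟨ A.◁-cong A.refl ([,]-∙ _ _ _) ⟨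
        to p ◁ ([ q , ε ] ∙ u)
          ≈⟨ A.◁-assoc _ _ _ ⟨
        to p ◁ [ q , ε ] ◁ u ∎ }
    }
    where
    open Hom r
    open SetoidReasoning A.setoid

  -- Equivariance of `r` turns the weakening `+` into `∘ +`; substituting `x` for the bound variable
  -- then undoes it, since `[ x , + ]` is the unit by `G3`.
  curry∘uncurry : ∀ r p → Hom.to (curry (uncurry r)) p ≈ᴬ Hom.to r p
  curry∘uncurry r p = begin
    to (p ◁ +) ◁ [ x , ε ]  ≈⟨ A.◁-cong (homo + p) G.refl ⟩
    (to p ∘ +) ◁ [ x , ε ]  ≈⟨ ∘-◁-[,] _ _ _ _ ⟩
    to p ◁ [ x , + ∙ ε ]    ≈⟨ A.◁-cong A.refl ([,]-cong A.refl (G.identityʳ +)) ⟩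
    to p ◁ [ x , + ]        ≈⟨ A.◁-cong A.refl [x,+]≈ε ⟩
    to p ◁ ε                ≈⟨ A.◁-identityʳ _ ⟩
    to p                    ∎
    where
    open Hom r
    open SetoidReasoning A.setoid

  -- With `𝒢` itself as the `genoid` field, the equality of underlying genoids is `refl`.
  lambdaGenoid : Hom act^act act → Hom act act^act → LambdaGenoid a ℓa g ℓg
  lambdaGenoid s r = record
    { genoid      = 𝒢
    ; abstraction = s
    ; application = uncurry r
    }

  isReflexiveLambda : ∀ s r → (∀ p → Hom.to r (Hom.to s p) ≈ᴬ p) →
                      IsReflexiveLambda (lambdaGenoid s r)
  isReflexiveLambda s r r∘s = record
    { β = λ p → A.trans (curry∘uncurry r (Hom.to s p)) (r∘s p) }

  isExtensiveLambda : ∀ s r → (∀ p → Hom.to r (Hom.to s p) ≈ᴬ p) →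
                      (∀ p → Hom.to s (Hom.to r p) ≈ᴬ p) →
                      IsExtensiveLambda (lambdaGenoid s r)
  isExtensiveLambda s r r∘s s∘r = record
    { isReflexiveLambda = isReflexiveLambda s r r∘s
    -- The round trip of `r` is removed under `s`, leaving `s` after `r`.
    ; η = λ p → A.trans (Hom.cong s (curry∘uncurry r p)) (s∘r p)
    }

  reflexive⇒underlies : Reflexive 𝒢 → UnderliesReflexiveLambda 𝒢
  reflexive⇒underlies ρ =
    lambdaGenoid section retraction , refl ,
    isReflexiveLambda section retraction retract
    where open IsRetractOf ρ

  extensive⇒underlies : Extensive 𝒢 → UnderliesExtensiveLambda 𝒢
  extensive⇒underlies ι =
    lambdaGenoid forth back , refl ,
    isExtensiveLambda forth back back∘forth forth∘back
    where open IsIsomorphicTo ι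

underlies⇒reflexive : (𝒢 : Genoid a ℓa g ℓg) →
                      UnderliesReflexiveLambda 𝒢 → Reflexive 𝒢
underlies⇒reflexive _ (Λ , refl , isReflexive) = record
  { section    = abstraction
  ; retraction = curry genoid application
  -- The retraction sends `p` to `(p ◁ +) · x` by definition, so `β` has exactly the required type.
  ; retract    = β
  }
  where
  open LambdaGenoid Λ
  open IsReflexiveLambda isReflexive

underlies⇒extensive : (𝒢 : Genoid a ℓa g ℓg) →
                      UnderliesExtensiveLambda 𝒢 → Extensive 𝒢
underlies⇒extensive _ (Λ , refl , isExtensive) = record
  { forth      = abstraction
  ; back       = curry genoid application
  ; back∘forth = β
  ; forth∘back = η
  }
  where
  open LambdaGenoid Λ
  open IsExtensiveLambda isExtensive

mainTheorem2 : {a ℓa g ℓg : Level} (𝒢 : Genoid a ℓa g ℓg) →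
    (Reflexive 𝒢 ⇔ UnderliesReflexiveLambda 𝒢) ×
    (Extensive 𝒢 ⇔ UnderliesExtensiveLambda 𝒢)
mainTheorem2 𝒢 =
  mk⇔ (reflexive⇒underlies 𝒢) (underlies⇒reflexive 𝒢) ,
  mk⇔ (extensive⇒underlies 𝒢) (underlies⇒extensive 𝒢)
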